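{- Let $V=\{a,b,c,d,e,f,g,h\}$ (eight distinct elements) and let $R=(\le_1,\le_2,\le_3,\le_4)$ be the $4$-representation on $V$ given by the following four linear orders, each listed in increasing order from left to right: $$\begin{array}{c|cccccccc} \le_1 & b & c & d & e & g & f & h & a \\ \le_2 & a & c & d & e & h & f & g & b \\ \le_3 & a & b & d & f & g & e & h & c \\ \le_4 & a & b & c & f & h & e & g & d \end{array}$$ Then the simplicial complex $\Delta=\Sigma(R)$ has Dushnik-Miller dimension $4$, but $\Delta$ is not a TD-Delaunay complex of $H_4\simeq\mathbb{R}^3$.
   Context: **Abstract simplicial complexes.** An abstract simplicial complex with vertex set $V$ is a set of subsets of $V$ (called faces) closed under taking subsets. **Dushnik-Miller dimension.** The Dushnik-Miller dimension of a poset $(\le,V)$ is the minimum number $d$ such that there exist $d$ linear extensions $\le_1,\dots,\le_d$ of $\le$ on $V$ whose intersection is $\le$, i.e. for all $x,y\in V$, $x\le y$ if and only if $x\le_i y$ for every $i\in\{1,\dots,d\}$. The Dushnik-Miller dimension of an abstract simplicial complex $\Delta$ is the Dushnik-Miller dimension of its inclusion poset $(\subseteq,\Delta)$. **Representations.** A $d$-representation $R$ on a set $V$ is a tuple of $d$ linear orders $\le_1,\dots,\le_d$ on $V$. An element $x\in V$ dominates a set $F\subseteq V$ in $\le_i$ if $f\le_i x$ for every $f\in F$; $x$ dominates $F$ (in $R$) if $x$ dominates $F$ in at least one of the orders $\le_i$. $\Sigma(R)$ is the set of all $F\subseteq V$ such that every $v\in V$ dominates $F$; it is an abstract simplicial complex.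 **TD-Delaunay complexes.** For an integer $d$, $H_d=\{x\in\mathbb{R}^d : x_1+\cdots+x_d=1\}$. For $c\in\mathbb{R}^d$, the regular simplex $S_c$ is $\{u\in H_d : u_i\le c_i \text{ for all } i\in\{1,\dots,d\}\}$; it is positive if $\sum_{i=1}^d c_i\ge 1$; its interior is $\{u\in H_d : u_i<c_i \text{ for all } i\}$. A point set $\mathcal{P}\subset H_d$ is in general position if for any two distinct $x,y\in\mathcal{P}$, $x_i\ne y_i$ for every $i$. For a finite $\mathcal{P}\subset H_d$ in general position, $\mathsf{TDD}(\mathcal{P})$ is the simplicial complex with vertex set $\mathcal{P}$ in which $F\subseteq\mathcal{P}$ is a face if and only if there exists a positive regular simplex $S$ with $S\cap\mathcal{P}=F$ and with no point of $\mathcal{P}$ in the interior of $S$. An abstract simplicial complex is a TD-Delaunay complex of $H_d\simeq\mathbb{R}^{d-1}$ if it equals $\mathsf{TDD}(\mathcal{P})$, up to relabelling of vertices (isomorphism), for some finite $\mathcal{P}\subset H_d$ in general position. -}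

module Defs where

open import Algebra.Bundles using (CommutativeMonoid)
open import Data.Bool.Base using (if_then_else_)
open import Data.Fin.Base using (Fin)
import Data.Fin.Properties as Fin
open import Data.Fin.Patterns
open import Data.Fin.Subset using (Subset; _∈_; _⊆_)
open import Data.Fin.Subset.Properties using (⊆-poset)
open import Data.Nat.Base as ℕ using (ℕ; suc)
import Data.Nat.Properties as ℕ
open import Data.Product.Base using (Σ; Σ-syntax; ∃-syntax; _×_; _,_; proj₁)
open import Data.Rational.Base as ℚ using (ℚ; 0ℚ; 1ℚ; ½; ∣_∣)
import Data.Rational.Properties as ℚ
open import Data.Vec.Base using (Vec; []; _∷_; lookup; tabulate)
import Data.Vec.Functional as Vector
open import Function.Base using (_on_)
open import Function.Bundles using (_⇔_; _↔_; Inverse)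
open import Level using (0ℓ)
open import Relation.Binary.Bundles using (Poset)
open import Relation.Binary.Core using (Rel; _⇒_)
import Relation.Binary.Construct.On as On
open import Relation.Binary.PropositionalEquality
  using (_≡_; refl; sym; cong; subst; isEquivalence; module ≡-Reasoning)
open import Relation.Binary.Structures using (IsTotalOrder)
open import Relation.Nullary.Decidable using (does; from-yes; _→-dec_)
open import Relation.Nullary.Negation using (¬_)

-- Real numbers as Cauchy sequences of rationals.  They form a setoid:
-- equality of reals is _≈_, not _≡_.

module Real where

  record ℝ : Set where
    constructor mkℝ
    field
      seq    : ℕ → ℚ
      cauchy : ∀ ε → 0ℚ ℚ.< ε →
               ∃[ N ] (∀ m n → N ℕ.≤ m → N ℕ.≤ n → ∣ seq m ℚ.- seq n ∣ ℚ.< ε)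

  open ℝ public

  infix  4 _≈_ _≤_ _<_
  infixl 6 _+_

  _≈_ : Rel ℝ 0ℓ
  x ≈ y = ∀ ε → 0ℚ ℚ.< ε →
          ∃[ N ] (∀ n → N ℕ.≤ n → ∣ seq x n ℚ.- seq y n ∣ ℚ.< ε)

  -- The slack ε makes _≤_ invariant under _≈_.
  _≤_ : Rel ℝ 0ℓ
  x ≤ y = ∀ ε → 0ℚ ℚ.< ε →
          ∃[ N ] (∀ n → N ℕ.≤ n → seq x n ℚ.≤ seq y n ℚ.+ ε)

  _<_ : Rel ℝ 0ℓ
  x < y = Σ[ ε ∈ ℚ ] 0ℚ ℚ.< ε ×
          ∃[ N ] (∀ n → N ℕ.≤ n → seq x n ℚ.+ ε ℚ.≤ seq y n)

  fromℚ : ℚ → ℝ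
  fromℚ q = mkℝ (λ _ → q) λ ε 0<ε → 0 , λ _ _ _ _ →
    subst (λ r → ∣ r ∣ ℚ.< ε) (sym (ℚ.+-inverseʳ q)) 0<ε

  0ℝ 1ℝ : ℝ
  0ℝ = fromℚ 0ℚ
  1ℝ = fromℚ 1ℚ

  private
    sub-interchange : ∀ p q r s →
      (p ℚ.+ q) ℚ.- (r ℚ.+ s) ≡ (p ℚ.- r) ℚ.+ (q ℚ.- s)
    sub-interchange p q r s = begin
      (p ℚ.+ q) ℚ.- (r ℚ.+ s)            ≡⟨ cong (p ℚ.+ q ℚ.+_) (ℚ.neg-distrib-+ r s) ⟩
      (p ℚ.+ q) ℚ.+ (ℚ.- r ℚ.+ ℚ.- s)    ≡⟨ interchange p q (ℚ.- r) (ℚ.- s) ⟩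
      (p ℚ.- r) ℚ.+ (q ℚ.- s)            ∎
      where
      open ≡-Reasoning
      open import Algebra.Properties.CommutativeSemigroup
        (CommutativeMonoid.commutativeSemigroup ℚ.+-0-commutativeMonoid)
        using (interchange)

    halves : ∀ ε → ½ ℚ.* ε ℚ.+ ½ ℚ.* ε ≡ ε
    halves ε = begin
      ½ ℚ.* ε ℚ.+ ½ ℚ.* ε  ≡⟨ ℚ.*-distribʳ-+ ε ½ ½ ⟨
      1ℚ ℚ.* ε             ≡⟨ ℚ.*-identityˡ ε ⟩
      ε                    ∎
      where open ≡-Reasoning

    half-positive : ∀ {ε} → 0ℚ ℚ.< ε → 0ℚ ℚ.< ½ ℚ.* ε
    half-positive {ε} 0<ε =
      subst (ℚ._< ½ ℚ.* ε) (ℚ.*-zeroʳ ½) (ℚ.*-monoʳ-<-pos ½ 0<ε)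

  _+_ : ℝ → ℝ → ℝ
  x + y = mkℝ (λ n → seq x n ℚ.+ seq y n) λ ε 0<ε →
    let (M , x-close) = cauchy x (½ ℚ.* ε) (half-positive 0<ε)
        (N , y-close) = cauchy y (½ ℚ.* ε) (half-positive 0<ε)
    in M ℕ.⊔ N , λ m n M⊔N≤m M⊔N≤n → let open ℚ.≤-Reasoning in begin-strict
      ∣ (seq x m ℚ.+ seq y m) ℚ.- (seq x n ℚ.+ seq y n) ∣
        ≡⟨ cong ∣_∣ (sub-interchange (seq x m) (seq y m) (seq x n) (seq y n)) ⟩
      ∣ (seq x m ℚ.- seq x n) ℚ.+ (seq y m ℚ.- seq y n) ∣
        ≤⟨ ℚ.∣p+q∣≤∣p∣+∣q∣ (seq x m ℚ.- seq x n) (seq y m ℚ.- seq y n) ⟩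
      ∣ seq x m ℚ.- seq x n ∣ ℚ.+ ∣ seq y m ℚ.- seq y n ∣
        <⟨ ℚ.+-mono-<
             (x-close m n (ℕ.m⊔n≤o⇒m≤o M N M⊔N≤m) (ℕ.m⊔n≤o⇒m≤o M N M⊔N≤n))
             (y-close m n (ℕ.m⊔n≤o⇒n≤o M N M⊔N≤m) (ℕ.m⊔n≤o⇒n≤o M N M⊔N≤n)) ⟩
      ½ ℚ.* ε ℚ.+ ½ ℚ.* ε
        ≡⟨ halves ε ⟩
      ε ∎

  sum : ∀ {d} → (Fin d → ℝ) → ℝ
  sum = Vector.foldr _+_ 0ℝ

open Real using (ℝ; 1ℝ; sum)

-- Abstract simplicial complexes on the finite vertex set Fin n.  As a
-- vertex set is part of the data, singletons need not be faces.

record SimplicialComplex (n : ℕ) : Set₁ where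
  field
    Face   : Subset n → Set
    closed : ∀ {F G} → F ⊆ G → Face G → Face F

-- Faces are compared as subsets: the proofs of being a face are ignored.
facePoset : ∀ {n} → SimplicialComplex n → Poset 0ℓ 0ℓ 0ℓ
facePoset {n} Δ = On.poset (⊆-poset n) (proj₁ {B = SimplicialComplex.Face Δ})

-- The direct image of F: j ∈ image π F when π⁻¹ j ∈ F.
image : ∀ {m n} → Fin m ↔ Fin n → Subset m → Subset n
image π F = tabulate λ j → lookup F (Inverse.from π j)

-- Isomorphism of set systems, i.e. equality up to relabelling of vertices.
_≅_ : ∀ {m n} → (Subset m → Set) → (Subset n → Set) → Set
_≅_ {m} {n} 𝓕 𝓖 = Σ[ π ∈ Fin m ↔ Fin n ] (∀ F → 𝓕 F ⇔ 𝓖 (image π F))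

module _ (P : Poset 0ℓ 0ℓ 0ℓ) where
  open Poset P

  record Realizer (d : ℕ) : Set₁ where
    field
      order        : Fin d → Rel Carrier 0ℓ
      isTotalOrder : ∀ i → IsTotalOrder _≈_ (order i)
      extends      : ∀ i → _≤_ ⇒ order i
      intersection : ∀ {x y} → x ≤ y ⇔ (∀ i → order i x y)

  HasDimension : ℕ → Set₁
  HasDimension d = Realizer d × (∀ k → Realizer k → d ℕ.≤ k)

HasDushnikMillerDimension : ∀ {n} → SimplicialComplex n → ℕ → Set₁
HasDushnikMillerDimension Δ = HasDimension (facePoset Δ)

record Representation (d n : ℕ) : Set₁ where
  field
    order        : Fin d → Rel (Fin n) 0ℓ
    isTotalOrder : ∀ i → IsTotalOrder _≡_ (order i)

module _ {d n} (R : Representation d n) where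
  open Representation R

  DominatesIn : Fin d → Fin n → Subset n → Set
  DominatesIn i x F = ∀ f → f ∈ F → order i f x

  Dominates : Fin n → Subset n → Set
  Dominates x F = ∃[ i ] DominatesIn i x F

  -- Σ(R)
  supremumComplex : SimplicialComplex n
  supremumComplex = record
    { Face   = λ F → ∀ v → Dominates v F
    ; closed = λ F⊆G G-face v →
        let (i , dom) = G-face v in i , λ f f∈F → dom f (F⊆G f∈F)
    }

module _ {d : ℕ} where
  open Real using (_≈_; _≤_; _<_)

  InH : (Fin d → ℝ) → Set
  InH x = sum x ≈ 1ℝ

  _≋_ : Rel (Fin d → ℝ) 0ℓ
  x ≋ y = ∀ i → x i ≈ y i

  InSimplex : (c u : Fin d → ℝ) → Set
  InSimplex c u = InH u × (∀ i → u i ≤ c i)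

  InInterior : (c u : Fin d → ℝ) → Set
  InInterior c u = InH u × (∀ i → u i < c i)

  Positive : (Fin d → ℝ) → Set
  Positive c = 1ℝ ≤ sum c

-- An n-element subset of H_d, enumerated without repetition; its subsets
-- are then the subsets of the index set Fin n.
record PointSet (d n : ℕ) : Set where
  field
    point    : Fin n → Fin d → ℝ
    inH      : ∀ j → InH (point j)
    distinct : ∀ {j k} → ¬ j ≡ k → ¬ point j ≋ point k

module _ {d n} (𝓟 : PointSet d n) where
  open PointSet 𝓟

  GeneralPosition : Set
  GeneralPosition =
    ∀ j k → ¬ point j ≋ point k → ∀ i → ¬ point j i Real.≈ point k i

  -- The equivalence says S_c ∩ 𝓟 = F.
  TDD : Subset n → Set
  TDD F = Σ[ c ∈ (Fin d → ℝ) ] Positive c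
    × (∀ j → j ∈ F ⇔ InSimplex c (point j))
    × (∀ j → ¬ InInterior c (point j))

-- The index d is the dimension of the ambient space of H_d ≃ ℝ^(d-1).
TDDelaunay : ∀ {m} → ℕ → SimplicialComplex m → Set
TDDelaunay d Δ = ∃[ n ] Σ[ 𝓟 ∈ PointSet d n ]
  GeneralPosition 𝓟 × (SimplicialComplex.Face Δ ≅ TDD 𝓟)

V : Set
V = Fin 8

-- Each row lists V in increasing order.
rows : Vec (Vec V 8) 4
rows = (b ∷ c ∷ d ∷ e ∷ g ∷ f ∷ h ∷ a ∷ [])
     ∷ (a ∷ c ∷ d ∷ e ∷ h ∷ f ∷ g ∷ b ∷ [])
     ∷ (a ∷ b ∷ d ∷ f ∷ g ∷ e ∷ h ∷ c ∷ [])
     ∷ (a ∷ b ∷ c ∷ f ∷ h ∷ e ∷ g ∷ d ∷ [])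
     ∷ []
  where
  a b c d e f g h : V
  a = 0F
  b = 1F
  c = 2F
  d = 3F
  e = 4F
  f = 5F
  g = 6F
  h = 7F

-- Zero-based, and the length of the vector if x does not occur.
position : ∀ {n k} → Fin n → Vec (Fin n) k → ℕ
position x []       = 0
position x (y ∷ ys) = if does (x Fin.≟ y) then 0 else suc (position x ys)

rank : Fin 4 → V → ℕ
rank i x = position x (lookup rows i)

rank-injective : ∀ i x y → rank i x ≡ rank i y → x ≡ y
rank-injective = from-yes (Fin.all? λ i → Fin.all? λ x → Fin.all? λ y →
  (rank i x ℕ.≟ rank i y) →-dec (x Fin.≟ y))

R : Representation 4 8
R = record
  { order        = λ i → ℕ._≤_ on rank i
  ; isTotalOrder = λ i → record
    { isPartialOrder = record
      { isPreorder = record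
        { isEquivalence = isEquivalence
        ; reflexive     = λ { refl → ℕ.≤-refl }
        ; trans         = ℕ.≤-trans
        }
      ; antisym = λ x≤y y≤x → rank-injective i _ _ (ℕ.≤-antisym x≤y y≤x)
      }
    ; total = λ x y → ℕ.≤-total (rank i x) (rank i y)
    }
  }

{-# OPTIONS --safe #-}

-- The lexicographic orders induced by R realize the face poset, and the four
-- vertices of a 3-dimensional face together with their opposite triangles form
-- a standard example, which forces four orders.
--
-- If Σ(R) were TD-Delaunay, the coordinates of the points would give four
-- strict orders on V in which every vertex dominates every face.  These
-- dominance conditions force, in each coordinate, a matching of {e, f} below
-- {g, h}.  Summing over the coordinates, 2 = Σᵢ (eᵢ + fᵢ) < Σᵢ (gᵢ + hᵢ) = 2.

module Submission where

open import Data.Bool.Base using (Bool; true; false; _∧_; _∨_; T; if_then_else_; f<t)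
import Data.Bool.Base as Bool
import Data.Bool.Properties as Bool
import Data.Empty as Empty
open import Data.Fin.Base using (Fin; zero; suc)
open import Data.Fin.Patterns
import Data.Fin.Properties as Fin
open import Data.Fin.Subset
  using (Subset; inside; outside; _∈_; _∉_; _⊆_; ⁅_⁆; _-_; _∪_; ⊥)
open import Data.Fin.Subset.Properties
  using (_∈?_; ∉⊥; ⊆-antisym; x∈⁅x⁆; x∈⁅y⁆⇒x≡y; x∈p∪q⁻; p─q⊆p; x∈p∧x≢y⇒x∈p-y)
open import Data.Integer.Base using (+_)
open import Data.Nat.Base as ℕ using (ℕ; suc)
import Data.Nat.Properties as ℕ
open import Data.Product.Base using (∃-syntax; _×_; _,_; proj₁; proj₂)
open import Data.Rational.Base as ℚ using (ℚ; 0ℚ; ½; ∣_∣)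
import Data.Rational.Properties as ℚ
open import Data.Rational.Solver using (module +-*-Solver)
import Data.Sum.Effectful.Left as Sumₗ
open import Data.Sum.Base as Sum using (_⊎_; inj₁; inj₂; [_,_]′)
open import Data.Vec.Base
  using (Vec; []; _∷_; here; there; lookup; map; reverse; tabulate; replicate; _[_]≔_)
import Data.Vec.Membership.Propositional as Vec
import Data.Vec.Properties as Vec
open import Data.Vec.Relation.Binary.Lex.Strict as Lex using (Lex-<; Lex-≤; this; next; base)
open import Data.Vec.Relation.Binary.Pointwise.Inductive using (Pointwise-≡⇒≡; ≡⇒Pointwise-≡)
open import Data.Vec.Relation.Unary.All as All using ()
open import Data.Vec.Relation.Unary.AllPairs using (AllPairs; _∷_; allPairs?)
open import Data.Vec.Relation.Unary.Any using (here; there; any?)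
open import Effect.Monad using (RawMonad)
open import Function.Base using (_∘_; _on_; id)
open import Function.Bundles using (_↔_; _⇔_; mk⇔; Equivalence; Inverse)
open import Level using (0ℓ)
open import Relation.Binary.Bundles using (Poset)
open import Relation.Binary.Core using (Rel)
open import Relation.Binary.PropositionalEquality
  using (_≡_; _≢_; refl; sym; trans; cong; subst; isEquivalence)
open import Relation.Binary.Structures using (IsTotalOrder; IsStrictTotalOrder)
open import Relation.Nullary.Decidable
  using (Dec; yes; no; True; toWitness; isYes; from-yes; ¬?; _×-dec_; _⊎-dec_; _→-dec_;
         decidable-stable)
open import Relation.Nullary.Negation using (¬_; contradiction; ¬¬-map; ¬¬-Monad)
open import Defs

open SimplicialComplex using (Face)

-- Real numbers

module Reals where
  open Real public
  open +-*-Solver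

  Eventually : (ℕ → Set) → Set
  Eventually P = ∃[ N ] (∀ n → N ℕ.≤ n → P n)

  zipWith : ∀ {P Q R : ℕ → Set} → (∀ n → P n → Q n → R n) →
    Eventually P → Eventually Q → Eventually R
  zipWith f (M , p) (N , q) = M ℕ.⊔ N , λ n M⊔N≤n →
    f n (p n (ℕ.m⊔n≤o⇒m≤o M N M⊔N≤n)) (q n (ℕ.m⊔n≤o⇒n≤o M N M⊔N≤n))

  p≤∣p∣ : ∀ p → p ℚ.≤ ∣ p ∣
  p≤∣p∣ p with ℚ.≤-total 0ℚ p
  ... | inj₁ 0≤p = ℚ.≤-reflexive (sym (ℚ.0≤p⇒∣p∣≡p 0≤p))
  ... | inj₂ p≤0 = ℚ.≤-trans p≤0 (ℚ.0≤∣p∣ p)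

  ∣p-q∣≡∣q-p∣ : ∀ p q → ∣ p ℚ.- q ∣ ≡ ∣ q ℚ.- p ∣
  ∣p-q∣≡∣q-p∣ p q = trans (sym (ℚ.∣-p∣≡∣p∣ (p ℚ.- q)))
    (cong ∣_∣ (solve 2 (λ p q → :- (p :- q) := q :- p) refl p q))

  ∣p-q∣<ε⇒p<q+ε : ∀ p q {ε} → ∣ p ℚ.- q ∣ ℚ.< ε → p ℚ.< q ℚ.+ ε
  ∣p-q∣<ε⇒p<q+ε p q {ε} close = begin-strict
    p                ≡⟨ solve 2 (λ p q → p := q :+ (p :- q)) refl p q ⟩
    q ℚ.+ (p ℚ.- q)  <⟨ ℚ.+-monoʳ-< q (ℚ.≤-<-trans (p≤∣p∣ (p ℚ.- q)) close) ⟩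
    q ℚ.+ ε          ∎
    where open ℚ.≤-Reasoning

  p<q+ε⇒p-q<ε : ∀ {p q ε} → p ℚ.< q ℚ.+ ε → p ℚ.- q ℚ.< ε
  p<q+ε⇒p-q<ε {p} {q} {ε} p<q+ε = begin-strict
    p ℚ.- q        <⟨ ℚ.+-monoˡ-< (ℚ.- q) p<q+ε ⟩
    q ℚ.+ ε ℚ.- q  ≡⟨ solve 2 (λ q ε → q :+ ε :- q := ε) refl q ε ⟩
    ε              ∎
    where open ℚ.≤-Reasoning

  ∣p-q∣<ε : ∀ {p q ε} → p ℚ.< q ℚ.+ ε → q ℚ.< p ℚ.+ ε → ∣ p ℚ.- q ∣ ℚ.< ε
  ∣p-q∣<ε {p} {q} {ε} p<q+ε q<p+ε with ℚ.∣p∣≡p∨∣p∣≡-p (p ℚ.- q)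
  ... | inj₁ eq = subst (ℚ._< ε) (sym eq) (p<q+ε⇒p-q<ε p<q+ε)
  ... | inj₂ eq = subst (ℚ._< ε)
    (trans (solve 2 (λ p q → q :- p := :- (p :- q)) refl p q) (sym eq)) (p<q+ε⇒p-q<ε q<p+ε)

  half-positive : ∀ {ε} → 0ℚ ℚ.< ε → 0ℚ ℚ.< ½ ℚ.* ε
  half-positive {ε} 0<ε =
    subst (ℚ._< ½ ℚ.* ε) (ℚ.*-zeroʳ ½) (ℚ.*-monoʳ-<-pos ½ 0<ε)

  ∣p+q∣<ε : ∀ p q {ε} → ∣ p ∣ ℚ.< ½ ℚ.* ε → ∣ q ∣ ℚ.< ½ ℚ.* ε → ∣ p ℚ.+ q ∣ ℚ.< ε
  ∣p+q∣<ε p q {ε} p-small q-small = begin-strict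
    ∣ p ℚ.+ q ∣              ≤⟨ ℚ.∣p+q∣≤∣p∣+∣q∣ p q ⟩
    ∣ p ∣ ℚ.+ ∣ q ∣          <⟨ ℚ.+-mono-< p-small q-small ⟩
    ½ ℚ.* ε ℚ.+ ½ ℚ.* ε      ≡⟨ solve 1 (λ ε → con ½ :* ε :+ con ½ :* ε := ε) refl ε ⟩
    ε                        ∎
    where open ℚ.≤-Reasoning

  ≡⇒≈ : ∀ x y → (∀ n → seq x n ≡ seq y n) → x ≈ y
  ≡⇒≈ x y eq ε 0<ε = 0 , λ n _ → subst (ℚ._< ε)
    (sym (cong ∣_∣ (trans (cong (ℚ._- seq y n) (eq n)) (ℚ.+-inverseʳ (seq y n))))) 0<ε

  ≈-sym : ∀ x y → x ≈ y → y ≈ x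
  ≈-sym x y x≈y ε 0<ε = let (N , close) = x≈y ε 0<ε in
    N , λ n N≤n → subst (ℚ._< ε) (∣p-q∣≡∣q-p∣ (seq x n) (seq y n)) (close n N≤n)

  ≈-trans : ∀ x y z → x ≈ y → y ≈ z → x ≈ z
  ≈-trans x y z x≈y y≈z ε 0<ε = zipWith (λ n p q → subst (λ r → ∣ r ∣ ℚ.< ε)
      (solve 3 (λ x y z → (x :- y) :+ (y :- z) := x :- z) refl (seq x n) (seq y n) (seq z n))
      (∣p+q∣<ε (seq x n ℚ.- seq y n) (seq y n ℚ.- seq z n) p q))
    (x≈y (½ ℚ.* ε) (half-positive 0<ε)) (y≈z (½ ℚ.* ε) (half-positive 0<ε))

  +-cong : ∀ x x′ y y′ → x ≈ x′ → y ≈ y′ → x + y ≈ x′ + y′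
  +-cong x x′ y y′ x≈x′ y≈y′ ε 0<ε = zipWith (λ n p q → subst (λ r → ∣ r ∣ ℚ.< ε)
      (solve 4 (λ x x′ y y′ → (x :- x′) :+ (y :- y′) := (x :+ y) :- (x′ :+ y′)) refl
        (seq x n) (seq x′ n) (seq y n) (seq y′ n))
      (∣p+q∣<ε (seq x n ℚ.- seq x′ n) (seq y n ℚ.- seq y′ n) p q))
    (x≈x′ (½ ℚ.* ε) (half-positive 0<ε)) (y≈y′ (½ ℚ.* ε) (half-positive 0<ε))

  <⇒≉ : ∀ x y → x < y → ¬ x ≈ y
  <⇒≉ x y (ε , 0<ε , x<y) x≈y =
    let (N , absurd) = zipWith both x<y (x≈y ε 0<ε) in absurd N ℕ.≤-refl
    where
    both : ∀ n → seq x n ℚ.+ ε ℚ.≤ seq y n → ¬ ∣ seq x n ℚ.- seq y n ∣ ℚ.< ε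
    both n p close = ℚ.<-irrefl refl (ℚ.<-≤-trans
      (∣p-q∣<ε⇒p<q+ε (seq y n) (seq x n)
        (subst (ℚ._< ε) (∣p-q∣≡∣q-p∣ (seq x n) (seq y n)) close)) p)

  <-trans : ∀ x y z → x < y → y < z → x < z
  <-trans x y z (ε , 0<ε , x<y) (δ , 0<δ , y<z) = ε , 0<ε , zipWith (λ n p q → begin
      seq x n ℚ.+ ε   ≤⟨ p ⟩
      seq y n         ≡⟨ ℚ.+-identityʳ (seq y n) ⟨
      seq y n ℚ.+ 0ℚ  ≤⟨ ℚ.+-monoʳ-≤ (seq y n) (ℚ.<⇒≤ 0<δ) ⟩
      seq y n ℚ.+ δ   ≤⟨ q ⟩
      seq z n         ∎)
    x<y y<z
    where open ℚ.≤-Reasoning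

  -- The gap of `x < y` is split in two: one half pays for the slack in `y ≤ z`, the other half
  -- remains as the gap between `x` and `z`.
  <-≤-trans : ∀ x y z → x < y → y ≤ z → x < z
  <-≤-trans x y z (ε , 0<ε , x<y) y≤z = δ , half-positive 0<ε , zipWith (λ n p q → begin
      seq x n ℚ.+ δ
        ≡⟨ solve 2 (λ x ε → x :+ con ½ :* ε := x :+ ε :- con ½ :* ε) refl (seq x n) ε ⟩
      seq x n ℚ.+ ε ℚ.- δ
        ≤⟨ ℚ.+-monoˡ-≤ (ℚ.- δ) p ⟩
      seq y n ℚ.- δ
        ≤⟨ ℚ.+-monoˡ-≤ (ℚ.- δ) q ⟩
      seq z n ℚ.+ δ ℚ.- δ
        ≡⟨ solve 2 (λ z δ → z :+ δ :- δ := z) refl (seq z n) δ ⟩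
      seq z n ∎)
    x<y (y≤z δ (half-positive 0<ε))
    where
    open ℚ.≤-Reasoning
    δ = ½ ℚ.* ε

  +-mono-< : ∀ x x′ y y′ → x < x′ → y < y′ → x + y < x′ + y′
  +-mono-< x x′ y y′ (ε , 0<ε , x<x′) (δ , 0<δ , y<y′) =
    ε ℚ.+ δ , ℚ.+-mono-< 0<ε 0<δ , zipWith (λ n p q → begin
      seq x n ℚ.+ seq y n ℚ.+ (ε ℚ.+ δ)
        ≡⟨ solve 4 (λ x y ε δ → x :+ y :+ (ε :+ δ) := (x :+ ε) :+ (y :+ δ)) refl
             (seq x n) (seq y n) ε δ ⟩
      (seq x n ℚ.+ ε) ℚ.+ (seq y n ℚ.+ δ)
        ≤⟨ ℚ.+-mono-≤ p q ⟩
      seq x′ n ℚ.+ seq y′ n ∎)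
    x<x′ y<y′
    where open ℚ.≤-Reasoning

  +-monoˡ-< : ∀ x x′ y → x < x′ → x + y < x′ + y
  +-monoˡ-< x x′ y (ε , 0<ε , N , x<x′) = ε , 0<ε , N , λ n N≤n → begin
      seq x n ℚ.+ seq y n ℚ.+ ε
        ≡⟨ solve 3 (λ x y ε → x :+ y :+ ε := x :+ ε :+ y) refl (seq x n) (seq y n) ε ⟩
      seq x n ℚ.+ ε ℚ.+ seq y n
        ≤⟨ ℚ.+-monoˡ-≤ (seq y n) (x<x′ n N≤n) ⟩
      seq x′ n ℚ.+ seq y n ∎
    where open ℚ.≤-Reasoning

  <-+-comm : ∀ x y z → x < y + z → x < z + y
  <-+-comm x y z (ε , 0<ε , N , x<y+z) = ε , 0<ε , N , λ n N≤n →
    subst (seq x n ℚ.+ ε ℚ.≤_) (ℚ.+-comm (seq y n) (seq z n)) (x<y+z n N≤n)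

  -- Strictness needs at least one summand. The base case compares one-term sums, which still carry
  -- the `0ℝ` at the end of the fold.
  sum-mono-< : ∀ {d} (x y : Fin (suc d) → ℝ) → (∀ i → x i < y i) → sum x < sum y
  sum-mono-< {ℕ.zero} x y x<y = +-monoˡ-< (x zero) (y zero) 0ℝ (x<y zero)
  sum-mono-< {suc d}  x y x<y = +-mono-< (x zero) (y zero) (sum (x ∘ suc)) (sum (y ∘ suc))
    (x<y zero) (sum-mono-< (x ∘ suc) (y ∘ suc) (x<y ∘ suc))

  sum-distrib-+ : ∀ {d} (x y : Fin d → ℝ) → sum (λ i → x i + y i) ≈ sum x + sum y
  sum-distrib-+ x y = ≡⇒≈ (sum (λ i → x i + y i)) (sum x + sum y) (pointwise x y)
    where
    pointwise : ∀ {d} (x y : Fin d → ℝ) n →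
      seq (sum (λ i → x i + y i)) n ≡ seq (sum x) n ℚ.+ seq (sum y) n
    pointwise {ℕ.zero} x y n = refl
    pointwise {suc d}  x y n = trans
      (cong (seq (x zero) n ℚ.+ seq (y zero) n ℚ.+_) (pointwise (x ∘ suc) (y ∘ suc) n))
      (solve 4 (λ p q r s → (p :+ q) :+ (r :+ s) := (p :+ r) :+ (q :+ s)) refl
        (seq (x zero) n) (seq (y zero) n) (seq (sum (x ∘ suc)) n) (seq (sum (y ∘ suc)) n))

  -- With δ = ε / 5, an index N beyond which both sequences vary by less than δ
  -- has yₙ < xₙ + 3δ at n = N, since otherwise xₙ + δ ≤ yₙ for all n ≥ N.
  ≮⇒eventually< : ∀ x y → ¬ x < y → ∀ ε → 0ℚ ℚ.< ε →
    Eventually (λ n → seq y n ℚ.< seq x n ℚ.+ ε)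
  ≮⇒eventually< x y x≮y ε 0<ε = N , λ n N≤n → begin-strict
      seq y n
        <⟨ close-y n N N≤n ℕ.≤-refl ⟩
      seq y N ℚ.+ δ
        <⟨ ℚ.+-monoˡ-< δ gap ⟩
      seq x N ℚ.+ 3δ ℚ.+ δ
        <⟨ ℚ.+-monoˡ-< δ (ℚ.+-monoˡ-< 3δ (close-x N n ℕ.≤-refl N≤n)) ⟩
      seq x n ℚ.+ δ ℚ.+ 3δ ℚ.+ δ
        ≡⟨ solve 2 (λ x ε → let δ = con ⅕ :* ε in x :+ δ :+ (δ :+ δ :+ δ) :+ δ := x :+ ε) refl
             (seq x n) ε ⟩
      seq x n ℚ.+ ε ∎
    where
    open ℚ.≤-Reasoning
    ⅕ = + 1 ℚ./ 5
    δ = ⅕ ℚ.* ε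
    3δ = δ ℚ.+ δ ℚ.+ δ
    0<δ : 0ℚ ℚ.< δ
    0<δ = subst (ℚ._< δ) (ℚ.*-zeroʳ ⅕) (ℚ.*-monoʳ-<-pos ⅕ 0<ε)
    Nx = proj₁ (cauchy x δ 0<δ)
    Ny = proj₁ (cauchy y δ 0<δ)
    N = Nx ℕ.⊔ Ny
    close-x : ∀ m n → N ℕ.≤ m → N ℕ.≤ n → seq x m ℚ.< seq x n ℚ.+ δ
    close-x m n N≤m N≤n = ∣p-q∣<ε⇒p<q+ε (seq x m) (seq x n)
      (proj₂ (cauchy x δ 0<δ) m n (ℕ.m⊔n≤o⇒m≤o Nx Ny N≤m) (ℕ.m⊔n≤o⇒m≤o Nx Ny N≤n))
    close-y : ∀ m n → N ℕ.≤ m → N ℕ.≤ n → seq y m ℚ.< seq y n ℚ.+ δ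
    close-y m n N≤m N≤n = ∣p-q∣<ε⇒p<q+ε (seq y m) (seq y n)
      (proj₂ (cauchy y δ 0<δ) m n (ℕ.m⊔n≤o⇒n≤o Nx Ny N≤m) (ℕ.m⊔n≤o⇒n≤o Nx Ny N≤n))
    gap : seq y N ℚ.< seq x N ℚ.+ 3δ
    gap = ℚ.≰⇒> λ far → x≮y (δ , 0<δ , N , λ n N≤n → ℚ.<⇒≤ (begin-strict
      seq x n ℚ.+ δ
        <⟨ ℚ.+-monoˡ-< δ (close-x n N N≤n ℕ.≤-refl) ⟩
      seq x N ℚ.+ δ ℚ.+ δ
        ≡⟨ solve 2 (λ x δ → x :+ δ :+ δ := x :+ (δ :+ δ :+ δ) :- δ) refl (seq x N) δ ⟩
      seq x N ℚ.+ 3δ ℚ.- δ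
        ≤⟨ ℚ.+-monoˡ-≤ (ℚ.- δ) far ⟩
      seq y N ℚ.- δ
        <⟨ ℚ.+-monoˡ-< (ℚ.- δ) (close-y N n ℕ.≤-refl N≤n) ⟩
      seq y n ℚ.+ δ ℚ.- δ
        ≡⟨ solve 2 (λ y δ → y :+ δ :- δ := y) refl (seq y n) δ ⟩
      seq y n ∎))

  ≉⇒¬¬<⊎> : ∀ x y → ¬ x ≈ y → ¬ ¬ (x < y ⊎ y < x)
  ≉⇒¬¬<⊎> x y x≉y incomparable = x≉y λ ε 0<ε → zipWith (λ _ → ∣p-q∣<ε)
    (≮⇒eventually< y x (incomparable ∘ inj₂) ε 0<ε)
    (≮⇒eventually< x y (incomparable ∘ inj₁) ε 0<ε)

-- Dushnik-Miller dimension

∉⇒lookup : ∀ {n} {x : Fin n} {F} → x ∉ F → lookup F x ≡ outside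
∉⇒lookup x∉F = Bool.¬-not (x∉F ∘ Vec.lookup⇒[]= _ _)

-- Lexicographic comparison of subsets

_≤ˡ_ _<ˡ_ : ∀ {k} → Rel (Vec Bool k) 0ℓ
_≤ˡ_ = Lex-≤ _≡_ Bool._<_
_<ˡ_ = Lex-< _≡_ Bool._<_

≤ˡ-isTotalOrder : ∀ {k} → IsTotalOrder _≡_ (_≤ˡ_ {k})
≤ˡ-isTotalOrder = record
  { isPartialOrder = record
    { isPreorder = record
      { isEquivalence = isEquivalence
      ; reflexive     = L.reflexive ∘ ≡⇒Pointwise-≡
      ; trans         = L.trans
      }
    ; antisym = λ p q → Pointwise-≡⇒≡ (L.antisym p q)
    }
  ; total = L.total
  }
  where module L = IsTotalOrder (Lex.≤-isTotalOrder Bool.<-isStrictTotalOrder)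

<ˡ⇒≱ˡ : ∀ {k} {p q : Vec Bool k} → p <ˡ q → ¬ q ≤ˡ p
<ˡ⇒≱ˡ p<q q≤p = Lex.<-irrefl S.irrefl (≡⇒Pointwise-≡ refl)
  (Lex.<-transˡ S.Eq.isPartialEquivalence S.<-resp-≈ S.trans p<q q≤p)
  where module S = IsStrictTotalOrder Bool.<-isStrictTotalOrder

module _ {n : ℕ} where

  -- The characteristic vector of `F`, read in the order of `xs`. When `xs` is descending,
  -- lexicographic comparison is decided by the largest vertex at which two sets differ.
  key : ∀ {k} → Vec (Fin n) k → Subset n → Vec Bool k
  key xs F = map (lookup F) xs

  -- A complete list makes the key determine the set; used in both directions, this gives
  -- antisymmetry.
  key-⊆ : ∀ {k} (xs : Vec (Fin n) k) {F G} →
    (∀ x → x Vec.∈ xs) → key xs F ≡ key xs G → F ⊆ G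
  key-⊆ xs {F} {G} complete eq {x} x∈F = Vec.lookup⇒[]= x G
    (trans (sym (agree xs eq (complete x))) (Vec.[]=⇒lookup x∈F))
    where
    agree : ∀ {k} (ys : Vec _ k) → key ys F ≡ key ys G →
            x Vec.∈ ys → lookup F x ≡ lookup G x
    agree (_ ∷ ys) eq (here refl)  = Vec.∷-injectiveˡ eq
    agree (_ ∷ ys) eq (there x∈ys) = agree ys (Vec.∷-injectiveʳ eq) x∈ys

  key-mono : ∀ {k} (xs : Vec (Fin n) k) {F G} → F ⊆ G → key xs F ≤ˡ key xs G
  key-mono [] F⊆G = base _
  key-mono (x ∷ xs) {F} {G} F⊆G with x ∈? F | x ∈? G
  ... | yes x∈F | _
    rewrite Vec.[]=⇒lookup x∈F | Vec.[]=⇒lookup (F⊆G x∈F) = next refl (key-mono xs F⊆G)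
  ... | no x∉F | no x∉G
    rewrite ∉⇒lookup x∉F | ∉⇒lookup x∉G = next refl (key-mono xs F⊆G)
  ... | no x∉F | yes x∈G
    rewrite ∉⇒lookup x∉F | Vec.[]=⇒lookup x∈G = this f<t refl

  -- Entries listed before `x` are not below `x`, so `G` contains none of them. Either `F` contains
  -- one of them and wins there, or the keys agree until `x`, where `F` wins.
  key-dominated : ∀ {k} {_≼_ : Rel (Fin n) 0ℓ} {xs : Vec (Fin n) k} {x F G} →
    AllPairs (λ y z → ¬ y ≼ z) xs → x Vec.∈ xs →
    x ∈ F → x ∉ G → (∀ y → y ∈ G → y ≼ x) → key xs G <ˡ key xs F
  key-dominated (_ ∷ _) (here refl) x∈F x∉G _
    rewrite Vec.[]=⇒lookup x∈F | ∉⇒lookup x∉G = this f<t refl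
  key-dominated {F = F} (y⋠ ∷ sorted) (there {x = y} x∈xs) x∈F x∉G dom
    rewrite ∉⇒lookup (λ y∈G → All.lookup y⋠ x∈xs (dom y y∈G)) with lookup F y
  ... | inside  = this f<t refl
  ... | outside = next refl (key-dominated sorted x∈xs x∈F x∉G dom)

-- F ≤ᵢ G when the ≤ᵢ-largest element of the symmetric difference of F and G
-- lies in G.
supremumRealizer : ∀ {d n k} (R : Representation d n) (xs : Fin d → Vec (Fin n) k) →
  (∀ i x → x Vec.∈ xs i) → (∀ i → AllPairs (λ y z → ¬ Representation.order R i y z) (xs i)) →
  Realizer (facePoset (supremumComplex R)) d
supremumRealizer R xs complete sorted = record
  { order        = λ i → _≤ˡ_ on λ F → key (xs i) (proj₁ F)
  ; isTotalOrder = λ i → record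
    { isPartialOrder = record
      { isPreorder = record
        { isEquivalence = record { refl = refl ; sym = sym ; trans = trans }
        ; reflexive     = λ { refl → L.refl }
        ; trans         = L.trans
        }
      ; antisym = λ p q → let eq = L.antisym p q in
          ⊆-antisym (key-⊆ (xs i) (complete i) eq) (key-⊆ (xs i) (complete i) (sym eq))
      }
    ; total = λ F G → L.total (key (xs i) (proj₁ F)) (key (xs i) (proj₁ G))
    }
  ; extends      = λ i → key-mono (xs i)
  ; intersection = λ {F} {G} → mk⇔ {A = proj₁ F ⊆ proj₁ G} (λ F⊆G i → key-mono (xs i) F⊆G)
      λ F≤G {x} x∈F →
      -- As `G` is a face, a vertex `x` of `F` outside `G` dominates `G` in some order `i`, and
      -- there `G` comes strictly before `F`.
      decidable-stable (x ∈? proj₁ G) λ x∉G → let (i , dom) = proj₂ G x in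
        <ˡ⇒≱ˡ (key-dominated (sorted i) (complete i x) x∈F x∉G dom) (F≤G i)
  }
  where module L {k} = IsTotalOrder (≤ˡ-isTotalOrder {k})

-- Lower bounds on the dimension from standard examples

module _ (P : Poset 0ℓ 0ℓ 0ℓ) where
  open Poset P

  -- Each pair `x i`, `y i` is reversed by some order. With fewer than `d` orders, two pairs share
  -- one, and there yᵢ ≤ xᵢ ≤ yⱼ ≤ xⱼ ≤ yᵢ collapses to an equality, against `x≰y`.
  standardExample : ∀ {d k} (x y : Fin d → Carrier) → (∀ i → ¬ x i ≤ y i) →
    (∀ {i j} → ¬ i ≡ j → x i ≤ y j) → Realizer P k → d ℕ.≤ k
  standardExample {d} {k} x y x≰y x≤y ρ = ℕ.≮⇒≥ λ k<d →
    let (i , j , i<j , same) = Fin.pigeonhole k<d (proj₁ ∘ reversed)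
        o , yᵢ≤xᵢ = reversed i
        yⱼ≤xⱼ     = subst (λ o → order o (y j) (x j)) (sym same) (proj₂ (reversed j))
        xᵢ≤yⱼ     = extends o (x≤y (Fin.<⇒≢ i<j))
        xⱼ≤yᵢ     = extends o (x≤y (Fin.<⇒≢ i<j ∘ sym))
        module T  = IsTotalOrder (isTotalOrder o)
    in x≰y i (Poset.reflexive P
         (T.antisym (T.trans xᵢ≤yⱼ (T.trans yⱼ≤xⱼ xⱼ≤yᵢ)) yᵢ≤xᵢ))
    where
    open Realizer ρ
    reversed : ∀ i → ∃[ o ] order o (y i) (x i)
    reversed i =
      [ id , (λ xᵢ≤yᵢ → contradiction (Equivalence.from intersection xᵢ≤yᵢ) (x≰y i)) ]′
      -- Totality decides each order in turn: the traversal stops with the first reversing order, or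
      -- else shows that all orders have xᵢ below yᵢ.
      (Fin.sequence (Sumₗ.applicative _ 0ℓ) {P = λ o → order o (x i) (y i)} λ o →
        [ inj₂ , inj₁ ∘ (o ,_) ]′ (IsTotalOrder.total (isTotalOrder o) (x i) (y i)))

x∉p-x : ∀ {n} (p : Subset n) x → x ∉ p - x
x∉p-x (_ ∷ p) 0F      ()
x∉p-x (_ ∷ p) (suc x) (there x∈) = x∉p-x p x x∈

-- The singletons of the `v i` and the sets `F - v i` are faces by closure. A singleton is contained
-- in each of these sets except its own partner, as a standard example requires.
faceOfSize⇒dimension≥ : ∀ {n d k} (Δ : SimplicialComplex n) {F} → Face Δ F →
  (v : Fin d → Fin n) → (∀ {i j} → v i ≡ v j → i ≡ j) → (∀ i → v i ∈ F) →
  Realizer (facePoset Δ) k → d ℕ.≤ k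
faceOfSize⇒dimension≥ Δ {F} F-face v v-injective v∈F =
  standardExample (facePoset Δ)
    (λ i → ⁅ v i ⁆ , closed (λ x∈ → subst (_∈ F) (sym (x∈⁅y⁆⇒x≡y (v i) x∈)) (v∈F i)) F-face)
    (λ i → F - v i , closed (p─q⊆p F ⁅ v i ⁆) F-face)
    (λ i ⁅v⁆⊆ → x∉p-x F (v i) (⁅v⁆⊆ (x∈⁅x⁆ (v i))))
    (λ {i} i≢j {x} x∈⁅v⁆ → subst (_∈ _) (sym (x∈⁅y⁆⇒x≡y (v i) x∈⁅v⁆))
       (x∈p∧x≢y⇒x∈p-y (v∈F i) (i≢j ∘ v-injective)))
  where open SimplicialComplex Δ

-- The dimension and the faces of Σ(R)

-- The rows are increasing, whereas a key needs its most significant vertex first.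
descending : Fin 4 → Vec V 8
descending i = reverse (lookup rows i)

descending-complete : ∀ i x → x Vec.∈ descending i
descending-complete = from-yes (Fin.all? λ i → Fin.all? λ x → any? (x Fin.≟_) (descending i))

descending-sorted : ∀ i → AllPairs (λ y z → ¬ rank i y ℕ.≤ rank i z) (descending i)
descending-sorted = from-yes (Fin.all? λ i →
  allPairs? (λ y z → ¬? (rank i y ℕ.≤? rank i z)) (descending i))

dominates? : ∀ x (F : Subset 8) → Dec (Dominates R x F)
dominates? x F = Fin.any? λ i → Fin.all? λ y → (y ∈? F) →-dec (rank i y ℕ.≤? rank i x)

face? : ∀ F → Dec (Face (supremumComplex R) F)
face? F = Fin.all? λ v → dominates? v F

pattern a = 0F
pattern b = 1F
pattern c = 2F
pattern d = 3F
pattern e = 4F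
pattern f = 5F
pattern g = 6F
pattern h = 7F

-- Bundling the proof ensures that a plan can invoke dominance only for genuine faces.
FaceΣ : Set
FaceΣ = ∃[ F ] Face (supremumComplex R) F

face : ∀ F → {True (face? F)} → FaceΣ
face F {F-face} = F , toWitness F-face

abcf abdf acde aceh acfh adef aefh bcde bcef bdeg bdfg befg cefh defg : FaceΣ
abcf = face (⁅ a ⁆ ∪ ⁅ b ⁆ ∪ ⁅ c ⁆ ∪ ⁅ f ⁆)
abdf = face (⁅ a ⁆ ∪ ⁅ b ⁆ ∪ ⁅ d ⁆ ∪ ⁅ f ⁆)
acde = face (⁅ a ⁆ ∪ ⁅ c ⁆ ∪ ⁅ d ⁆ ∪ ⁅ e ⁆)
aceh = face (⁅ a ⁆ ∪ ⁅ c ⁆ ∪ ⁅ e ⁆ ∪ ⁅ h ⁆)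
acfh = face (⁅ a ⁆ ∪ ⁅ c ⁆ ∪ ⁅ f ⁆ ∪ ⁅ h ⁆)
adef = face (⁅ a ⁆ ∪ ⁅ d ⁆ ∪ ⁅ e ⁆ ∪ ⁅ f ⁆)
aefh = face (⁅ a ⁆ ∪ ⁅ e ⁆ ∪ ⁅ f ⁆ ∪ ⁅ h ⁆)
bcde = face (⁅ b ⁆ ∪ ⁅ c ⁆ ∪ ⁅ d ⁆ ∪ ⁅ e ⁆)
bcef = face (⁅ b ⁆ ∪ ⁅ c ⁆ ∪ ⁅ e ⁆ ∪ ⁅ f ⁆)
bdeg = face (⁅ b ⁆ ∪ ⁅ d ⁆ ∪ ⁅ e ⁆ ∪ ⁅ g ⁆)
bdfg = face (⁅ b ⁆ ∪ ⁅ d ⁆ ∪ ⁅ f ⁆ ∪ ⁅ g ⁆)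
befg = face (⁅ b ⁆ ∪ ⁅ e ⁆ ∪ ⁅ f ⁆ ∪ ⁅ g ⁆)
cefh = face (⁅ c ⁆ ∪ ⁅ e ⁆ ∪ ⁅ f ⁆ ∪ ⁅ h ⁆)
defg = face (⁅ d ⁆ ∪ ⁅ e ⁆ ∪ ⁅ f ⁆ ∪ ⁅ g ⁆)

dimension : HasDushnikMillerDimension (supremumComplex R) 4
dimension = supremumRealizer R descending descending-complete descending-sorted ,
  λ k → faceOfSize⇒dimension≥ (supremumComplex R) (proj₂ abcf) (lookup vertices)
    (λ {i} {j} → vertices-injective i j)
    (from-yes (Fin.all? λ i → lookup vertices i ∈? proj₁ abcf))
  where
  vertices : Vec V 4
  vertices = a ∷ b ∷ c ∷ f ∷ []
  vertices-injective : ∀ i j → lookup vertices i ≡ lookup vertices j → i ≡ j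
  vertices-injective = from-yes (Fin.all? λ i → Fin.all? λ j →
    (lookup vertices i Fin.≟ lookup vertices j) →-dec (i Fin.≟ j))

-- Refutation by dominance

infixr 5 _▹_⨾_
infixr 4 _∥_

-- v ▹ F ⨾ p distinguishes the orders in which v may dominate F and follows p in
-- each case that is not yet contradictory; p ∥ q closes the case by p or by q.
data Plan : Set where
  stop  : Plan
  _▹_⨾_ : V → FaceΣ → Plan → Plan
  _∥_   : Plan → Plan → Plan

-- Found by computer search.  The first line distinguishes the 24 ways in which
-- the vertices of defg can be the maxima of defg in the four orders.
plan : Plan
plan =
  d ▹ defg ⨾ e ▹ defg ⨾ f ▹ defg ⨾ g ▹ defg ⨾
  e ▹ bdfg ⨾ d ▹ befg ⨾ f ▹ bdeg ⨾ b ▹ adef ⨾ b ▹ defg ⨾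
  g ▹ bcef ⨾ g ▹ abdf ⨾ g ▹ bcde ⨾ f ▹ acde ⨾
  ( a ▹ bdfg ⨾ d ▹ abcf ⨾ c ▹ bdeg ⨾ b ▹ acfh ⨾ b ▹ cefh ⨾ b ▹ aceh ⨾
    h ▹ abcf ⨾ b ▹ aefh ⨾ stop
  ∥ c ▹ adef ⨾ e ▹ acfh ⨾ a ▹ aefh ⨾ f ▹ aefh ⨾ h ▹ adef ⨾ c ▹ cefh ⨾
    h ▹ cefh ⨾ h ▹ acde ⨾ h ▹ acfh ⨾ stop )

-- A Boolean test, so that a plan is checked by evaluation; the common element is recovered in
-- `meets-sound`.
meets : ∀ {n} → Subset n → Subset n → Bool
meets []      []      = false
meets (s ∷ p) (t ∷ q) = (s ∧ t) ∨ meets p q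

meets-sound : ∀ {n} (p q : Subset n) → T (meets p q) → ∃[ x ] x ∈ p × x ∈ q
meets-sound []          []          ()
meets-sound (true  ∷ p) (true  ∷ q) _   = 0F , here , here
meets-sound (false ∷ p) (_     ∷ q) met =
  let (x , x∈p , x∈q) = meets-sound p q met in suc x , there x∈p , there x∈q
meets-sound (true  ∷ p) (false ∷ q) met =
  let (x , x∈p , x∈q) = meets-sound p q met in suc x , there x∈p , there x∈q

all : ∀ {n} → (Fin n → Bool) → Bool
all {ℕ.zero}  P = true
all {ℕ.suc n} P = P 0F ∧ all (P ∘ suc)

all-sound : ∀ {n} (P : Fin n → Bool) → T (all P) → ∀ i → T (P i)
all-sound P ok 0F      = proj₁ (Equivalence.to Bool.T-∧ ok)
all-sound P ok (suc i) = all-sound (P ∘ suc) (proj₂ (Equivalence.to Bool.T-∧ ok)) i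

-- The orders are abstract here, so checking the plan never touches real numbers. Dominance is over
-- `F - v` because the orders are strict and `v` may belong to `F`.
module Refutation
  (_<[_]_ : V → Fin 4 → V → Set)
  (<-irrefl : ∀ i x → ¬ x <[ i ] x)
  (<-trans : ∀ i x y z → x <[ i ] y → y <[ i ] z → x <[ i ] z)
  (dominated : ∀ F → Face (supremumComplex R) F → ∀ v →
     ∃[ i ] ∀ x → x ∈ F - v → x <[ i ] v)
  (no-crossing : ¬ (∀ i → (e <[ i ] g × f <[ i ] h) ⊎ (e <[ i ] h × f <[ i ] g)))
  where

  -- The inequalities known so far, closed under transitivity, as the upper sets
  -- of the vertices in each order.
  Store : Set
  Store = Vec (Vec (Subset 8) 8) 4

  above : Store → Fin 4 → V → Subset 8
  above S i x = lookup (lookup S i) x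

  Sound : Store → Set
  Sound S = ∀ i x y → y ∈ above S i x → x <[ i ] y

  ∅ : Store
  ∅ = replicate 4 (replicate 8 ⊥)

  module _ (S : Store) (i : Fin 4) (v : V) (F : Subset 8) where

    -- Incremental transitive closure: putting `F - v` below `v` affects those `x` that lie in
    -- `F - v` or below one of its elements. Each of them also comes below everything already above
    -- `v`.
    row : V → Subset 8
    row x = if meets (⁅ x ⁆ ∪ above S i x) (F - v)
      then above S i x ∪ (⁅ v ⁆ ∪ above S i v)
      else above S i x

    insert : Store
    insert = S [ i ]≔ tabulate row

    insert-sound : (∀ x → x ∈ F - v → x <[ i ] v) → Sound S → Sound insert
    insert-sound dom sound j x y y∈ with j Fin.≟ i
    ... | no j≢i = sound j x y
      (subst (λ r → y ∈ lookup r x) (Vec.lookup∘updateAt′ j i j≢i S) y∈)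
    ... | yes refl = row-sound (subst (y ∈_) lookup-row y∈)
      where
      lookup-row : above insert i x ≡ row x
      lookup-row = trans (cong (λ r → lookup r x) (Vec.lookup∘updateAt i S))
        (Vec.lookup∘tabulate row x)
      met⇒< : T (meets (⁅ x ⁆ ∪ above S i x) (F - v)) → x <[ i ] v
      met⇒< met with meets-sound (⁅ x ⁆ ∪ above S i x) (F - v) met
      ... | z , x≤z , z∈F with x∈p∪q⁻ ⁅ x ⁆ _ x≤z
      ...   | inj₁ z∈⁅x⁆ = subst (_<[ i ] v) (x∈⁅y⁆⇒x≡y x z∈⁅x⁆) (dom z z∈F)
      ...   | inj₂ x<z   = <-trans i x z v (sound i x z x<z) (dom z z∈F)
      row-sound : y ∈ row x → x <[ i ] y
      row-sound y∈ with meets (⁅ x ⁆ ∪ above S i x) (F - v) in eq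
      ... | false = sound i x y y∈
      ... | true  with x∈p∪q⁻ (above S i x) _ y∈
      ...   | inj₁ x<y = sound i x y x<y
      ...   | inj₂ v≤y with x∈p∪q⁻ ⁅ v ⁆ _ v≤y
      ...     | inj₁ y∈⁅v⁆ = subst (x <[ i ]_) (sym (x∈⁅y⁆⇒x≡y v y∈⁅v⁆))
        (met⇒< (subst T (sym eq) _))
      ...     | inj₂ v<y   = <-trans i x v y (met⇒< (subst T (sym eq) _)) (sound i v y v<y)

  crossing? : ∀ S → Dec (∀ i →
    (g ∈ above S i e × h ∈ above S i f) ⊎ (h ∈ above S i e × g ∈ above S i f))
  crossing? S = Fin.all? λ i →
    ((g ∈? above S i e) ×-dec (h ∈? above S i f)) ⊎-dec
    ((h ∈? above S i e) ×-dec (g ∈? above S i f))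

  -- An order is ruled out for `v` when some element of `F - v` is already known to lie above `v`.
  -- Any other order must be refuted with the new inequalities added. A surviving leaf is accepted
  -- only if the store contains a matching of `e`, `f` below `g`, `h` in all four orders.
  refutes : Plan → Store → Bool
  refutes stop              S = isYes (crossing? S)
  refutes (p ∥ q)           S = refutes p S ∨ refutes q S
  refutes (v ▹ (F , _) ⨾ p) S = all λ i →
    meets (above S i v) (F - v) ∨ refutes p (insert S i v F)

  refutes-sound : ∀ p S → T (refutes p S) → ¬ Sound S
  refutes-sound stop S crossing sound = no-crossing λ i → Sum.map
    (λ (eg , fh) → sound i e g eg , sound i f h fh)
    (λ (eh , fg) → sound i e h eh , sound i f g fg)
    (toWitness {a? = crossing? S} crossing i)
  refutes-sound (p ∥ q) S ok =
    [ refutes-sound p S , refutes-sound q S ]′ (Equivalence.to Bool.T-∨ ok)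
  refutes-sound (v ▹ (F , F-face) ⨾ p) S ok sound =
    -- All four orders have been checked; dominance selects the one whose branch applies.
    let (i , dom) = dominated F F-face v in
    [ (λ met → let (x , v<x , x∈F) = meets-sound (above S i v) (F - v) met in
         <-irrefl i v (<-trans i v x v (sound i v x v<x) (dom x x∈F)))
    , (λ ok → refutes-sound p (insert S i v F) ok (insert-sound S i v F dom sound))
    ]′ (Equivalence.to Bool.T-∨ (all-sound
      (λ i → meets (above S i v) (F - v) ∨ refutes p (insert S i v F)) ok i))

  impossible : Empty.⊥
  impossible = refutes-sound plan ∅ (subst T (sym checked) _) ∅-sound
    where
    ∅-sound : Sound ∅
    ∅-sound i x y y∈ = contradiction (subst (y ∈_) above-∅ y∈) ∉⊥
      where
      above-∅ : above ∅ i x ≡ ⊥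
      above-∅ = trans (cong (λ r → lookup r x) (Vec.lookup-replicate i _))
        (Vec.lookup-replicate x ⊥)
    -- The entire case analysis is carried out by normalising this equation.
    checked : refutes plan ∅ ≡ true
    checked = refl

-- TD-Delaunay complexes

module _ {n} (𝓟 : PointSet 4 n) (general : GeneralPosition 𝓟)
  (π : Fin 8 ↔ Fin n)
  (iso : ∀ F → Face (supremumComplex R) F ⇔ TDD 𝓟 (image π F)) where
  open Reals
  open PointSet 𝓟
  open Inverse π using (to; from; strictlyInverseʳ)

  coordinate : V → Fin 4 → ℝ
  coordinate v = point (to v)

  to-injective : ∀ {x y} → to x ≡ to y → x ≡ y
  to-injective {x} {y} eq =
    trans (sym (strictlyInverseʳ x)) (trans (cong from eq) (strictlyInverseʳ y))

  coordinate-≉ : ∀ i x y → x ≢ y → ¬ coordinate x i ≈ coordinate y i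
  coordinate-≉ i x y x≢y = general (to x) (to y) (distinct (x≢y ∘ to-injective)) i

  to-image : ∀ {x F} → x ∈ F → to x ∈ image π F
  to-image {x} {F} x∈F = Vec.lookup⇒[]= (to x) (image π F)
    (trans (Vec.lookup∘tabulate _ (to x))
      (trans (cong (lookup F) (strictlyInverseʳ x)) (Vec.[]=⇒lookup x∈F)))

  Comparable : Fin 4 → V → V → Set
  Comparable i x y = x ≢ y → coordinate x i < coordinate y i ⊎ coordinate y i < coordinate x i

  -- Double negation commutes with quantifiers over finite types, so all the comparisons may be
  -- assumed at once when the goal is a contradiction.
  comparable : ¬ ¬ (∀ i x y → Comparable i x y)
  comparable = sequence λ i → sequence λ x → sequence λ y → compare i x y
    where
    sequence : ∀ {m} {P : Fin m → Set} → (∀ j → ¬ ¬ P j) → ¬ ¬ (∀ j → P j)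
    sequence = Fin.sequence (RawMonad.rawApplicative ¬¬-Monad)
    compare : ∀ i x y → ¬ ¬ Comparable i x y
    compare i x y with x Fin.≟ y
    -- The inner `contradiction` proves the vacuous claim for equal vertices; the outer one
    -- double-negates it.
    ... | yes x≡y = contradiction (contradiction x≡y)
    ... | no x≢y  = ¬¬-map (λ x<>y _ → x<>y)
      (≉⇒¬¬<⊎> (coordinate x i) (coordinate y i) (coordinate-≉ i x y x≢y))

  -- Either matching yields the same strict inequality between the pair sums, although both pair
  -- sums total 2 over the coordinates.
  ¬crossing : ¬ (∀ i →
    (coordinate e i < coordinate g i × coordinate f i < coordinate h i) ⊎
    (coordinate e i < coordinate h i × coordinate f i < coordinate g i))
  ¬crossing crossing = <⇒≉ (sum e+f) (sum g+h) (sum-mono-< e+f g+h e+f<g+h)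
    (≈-trans (sum e+f) (1ℝ + 1ℝ) (sum g+h) (sum≈2 e f)
      (≈-sym (sum g+h) (1ℝ + 1ℝ) (sum≈2 g h)))
    where
    pairSum : V → V → Fin 4 → ℝ
    pairSum x y i = coordinate x i + coordinate y i
    e+f = pairSum e f
    g+h = pairSum g h
    e+f<g+h : ∀ i → e+f i < g+h i
    e+f<g+h i with crossing i
    ... | inj₁ (e<g , f<h) = +-mono-<
      (coordinate e i) (coordinate g i) (coordinate f i) (coordinate h i) e<g f<h
    ... | inj₂ (e<h , f<g) = <-+-comm (e+f i) (coordinate h i) (coordinate g i) (+-mono-<
      (coordinate e i) (coordinate h i) (coordinate f i) (coordinate g i) e<h f<g)
    sum≈2 : ∀ x y → sum (pairSum x y) ≈ 1ℝ + 1ℝ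
    sum≈2 x y = ≈-trans (sum (pairSum x y)) (sum (coordinate x) + sum (coordinate y)) (1ℝ + 1ℝ)
      (sum-distrib-+ (coordinate x) (coordinate y))
      (+-cong (sum (coordinate x)) 1ℝ (sum (coordinate y)) 1ℝ (inH (to x)) (inH (to y)))

  <-irreflexive : ∀ i x → ¬ coordinate x i < coordinate x i
  <-irreflexive i x x<x = <⇒≉ (coordinate x i) (coordinate x i) x<x
    (≡⇒≈ (coordinate x i) (coordinate x i) λ _ → refl)

  module _ (compare : ∀ i x y → Comparable i x y) where

    -- Decidability of the coordinate orders, obtained from the assumed comparisons, makes the
    -- search for a dominating order a finite one.
    less? : ∀ i x y → Dec (coordinate x i < coordinate y i)
    less? i x y with x Fin.≟ y
    ... | yes refl = no (<-irreflexive i x)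
    ... | no x≢y with compare i x y x≢y
    ...   | inj₁ x<y = yes x<y
    ...   | inj₂ y<x = no λ x<y → <-irreflexive i x
      (<-trans (coordinate x i) (coordinate y i) (coordinate x i) x<y y<x)

    -- If `v` were undominated, then in each coordinate some point of `F - v` would exceed `v`. That
    -- point lies in the simplex of `F`, so `v` would be strictly below the corner in every
    -- coordinate, hence in the forbidden interior.
    dominatedFace : ∀ F → Face (supremumComplex R) F → ∀ v →
      ∃[ i ] ∀ x → x ∈ F - v → coordinate x i < coordinate v i
    dominatedFace F F-face v = decidable-stable (Fin.any? (Fin.all? ∘ below?)) λ undominated →
      ¬interior (to v) (inH (to v) , λ i →
        let (x , x≮v) = Fin.¬∀⟶∃¬ 8 _ (below? i) λ below → undominated (i , below)
            -- `x≮v` refutes an implication, so its premise holds and its conclusion fails; the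
            -- comparison then gives `v<x`.
            x∈F-v = decidable-stable (x ∈? F - v) λ x∉ → x≮v λ x∈ → contradiction x∈ x∉
            x≢v   = λ x≡v → x∉p-x F v (subst (_∈ F - v) x≡v x∈F-v)
            v<x   = [ (λ x<v → contradiction (λ _ → x<v) x≮v) , id ]′ (compare i x v x≢v)
            x≤c   = proj₂ (Equivalence.to (members (to x)) (to-image (p─q⊆p F ⁅ v ⁆ x∈F-v))) i
        in <-≤-trans (coordinate v i) (coordinate x i) (corner i) v<x x≤c)
      where
      tdd = Equivalence.to (iso F) F-face
      corner = proj₁ tdd
      members = proj₁ (proj₂ (proj₂ tdd))
      ¬interior = proj₂ (proj₂ (proj₂ tdd))
      below? : ∀ i x → Dec (x ∈ F - v → coordinate x i < coordinate v i)
      below? i x = (x ∈? F - v) →-dec less? i x v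

  noRealization : Empty.⊥
  noRealization = comparable λ compare → Refutation.impossible
    (λ x i y → coordinate x i < coordinate y i)
    <-irreflexive
    (λ i x y z → <-trans (coordinate x i) (coordinate y i) (coordinate z i))
    (dominatedFace compare)
    ¬crossing

theorem28 : HasDushnikMillerDimension (supremumComplex R) 4 × ¬ TDDelaunay 4 (supremumComplex R)
theorem28 = dimension , λ (_ , 𝓟 , general , π , iso) → noRealization 𝓟 general π iso
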